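{- Let $S$ be a specular set on the finite alphabet $A$ relative to the involution $\theta$, and let $\mathcal{T}_0,\mathcal{T}_1$ be the two trees such that $\mathcal{E}(\varepsilon)=\mathcal{T}_0\cup\mathcal{T}_1$. For any $a,b\in A$ and $i\in\{0,1\}$, the edge $(1\otimes a,b\otimes1)$ is in $\mathcal{T}_i$ if and only if the edge $(1\otimes b^{ -1},a^{ -1}\otimes1)$ is in $\mathcal{T}_{1-i}$.
   Context: Words are over a finite alphabet $A$; $\varepsilon$ is the empty word. A set $S$ of words on $A$ is factorial if it contains $A$ and all the factors of its elements. For $w\in S$ let $L(w)=\{a\in A\mid aw\in S\}$, $R(w)=\{a\in A\mid wa\in S\}$, $B(w)=\{(a,b)\in A\times A\mid awb\in S\}$. A factorial set $S$ is biextendable if $B(w)\neq\emptyset$ for all $w\in S$. The extension graph $\mathcal{E}(w)$ is the undirected graph whose vertex set is the disjoint union of $L(w)$ and $R(w)$, the copy of $a\in L(w)$ being denoted $1\otimes a$ and the copy of $b\in R(w)$ being denoted $b\otimes 1$, with an edge $(1\otimes a,b\otimes1)$ for each $(a,b)\in B(w)$. A biextendable set $S$ is a tree set of characteristic $c$ if $\mathcal{E}(w)$ is a tree for every nonempty $w\in S$ and $\mathcal{E}(\varepsilon)$ is a disjoint union of $c$ trees. Let $\theta$ be an involution on $A$ (possibly with fixed points) and let $G_\theta$ be the group generated by $A$ with relations $a\theta(a)=1$, $a\in A$ (so $a^{ -1}=\theta(a)$). A word is reduced if it has no factor $a\theta(a)$ with $a\in A$; the inverse of a reduced word $a_1\cdots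 a_n$ is the reduced word $\theta(a_n)\cdots\theta(a_1)$. A laminary set on $A$ relative to $\theta$ is a biextendable set of reduced words closed under taking inverses. A specular set is a laminary set which is a tree set of characteristic $2$. -}

module Defs where

open import Level using (0ℓ)
open import Data.Empty using (⊥)
open import Data.Fin.Base using (Fin)
open import Data.List.Base using (List; []; _∷_; _∷ʳ_; [_]; map; reverse)
open import Data.List.Relation.Binary.Infix.Heterogeneous using (Infix; here; there; _ⁱ++_)
import Data.List.Relation.Binary.Pointwise as Pointwise
open import Data.List.Relation.Binary.Prefix.Heterogeneous.Properties using (fromPointwise)
open import Data.List.Relation.Unary.Linked using (Linked)
open import Data.List.Relation.Unary.Unique.Propositional using (Unique)
open import Data.Nat.Base using (ℕ)
open import Data.Product.Base using (_×_; _,_; ∃)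
open import Data.Sum.Base using (_⊎_; inj₁; inj₂; [_,_]′)
open import Function.Bundles using (_⇔_)
open import Relation.Binary.Construct.Closure.ReflexiveTransitive using (Star)
open import Relation.Binary.Core using (Rel)
open import Relation.Binary.Definitions using (Symmetric)
open import Relation.Binary.PropositionalEquality using (_≡_; _≢_; refl)
open import Relation.Nullary.Negation using (¬_)
open import Relation.Unary using (Pred; Satisfiable)

-- Simple undirected graphs, each edge being recorded in both directions,
-- whose vertices form a subset of X.
record Graph (X : Set) : Set₁ where
  field
    Vertex      : Pred X 0ℓ
    Edge        : Rel X 0ℓ
    endpoint    : ∀ {u v} → Edge u v → Vertex u
    symmetric   : Symmetric Edge
    irreflexive : ∀ {v} → ¬ Edge v v

open Graph public

Connected : ∀ {X} → Graph X → Set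
Connected G = ∀ {u v} → Vertex G u → Vertex G v → Star (Edge G) u v

-- A cycle is a closed walk x, y, z, …, x through at least three
-- vertices, pairwise distinct except that the first is repeated last.
Acyclic : ∀ {X} → Graph X → Set
Acyclic {X} G = ∀ (x y z : X) vs → Unique (x ∷ y ∷ z ∷ vs) →
                ¬ Linked (Edge G) (x ∷ y ∷ z ∷ (vs ∷ʳ x))

record IsTree {X : Set} (G : Graph X) : Set where
  field
    nonempty  : Satisfiable (Vertex G)
    connected : Connected G
    acyclic   : Acyclic G

record IsDisjointUnionOfTrees {X : Set} {c} (G : Graph X) (T : Fin c → Graph X) : Set where
  field
    trees       : ∀ i → IsTree (T i)
    disjoint    : ∀ {i j v} → Vertex (T i) v → Vertex (T j) v → i ≡ j
    vertexUnion : ∀ v → Vertex G v ⇔ ∃ λ i → Vertex (T i) v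
    edgeUnion   : ∀ u v → Edge G u v ⇔ ∃ λ i → Edge (T i) u v

record FactorialSet (A : Set) : Set₁ where
  field
    Word    : Pred (List A) 0ℓ
    letters : ∀ a → Word [ a ]
    factors : ∀ {u w} → Infix _≡_ u w → Word w → Word u

open FactorialSet public

pattern 1⊗_ a = inj₁ a
pattern _⊗1 b = inj₂ b

module _ {A : Set} (S : FactorialSet A) where

  L R : List A → Pred A 0ℓ
  L w a = Word S (a ∷ w)
  R w b = Word S (w ∷ʳ b)

  B : List A → Pred (A × A) 0ℓ
  B w (a , b) = Word S (a ∷ (w ∷ʳ b))

  ExtensionEdge : List A → Rel (A ⊎ A) 0ℓ
  ExtensionEdge w (1⊗ a) (b ⊗1) = B w (a , b)
  ExtensionEdge w (b ⊗1) (1⊗ a) = B w (a , b)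
  ExtensionEdge w (1⊗ _) (1⊗ _) = ⊥
  ExtensionEdge w (_ ⊗1) (_ ⊗1) = ⊥

  private
    refl-infix : ∀ (w : List A) → Infix _≡_ w w
    refl-infix w = here (fromPointwise (Pointwise.refl refl))

  extensionGraph : List A → Graph (A ⊎ A)
  extensionGraph w = record
    { Vertex      = [ L w , R w ]′
    ; Edge        = ExtensionEdge w
    ; endpoint    = λ {u} {v} → end u v
    ; symmetric   = λ {u} {v} → sym u v
    ; irreflexive = λ {v} → irr v
    }
    where
    end : ∀ u v → ExtensionEdge w u v → [ L w , R w ]′ u
    end (1⊗ a) (b ⊗1) = factors S (refl-infix (a ∷ w) ⁱ++ [ b ])
    end (b ⊗1) (1⊗ a) = factors S (there (refl-infix (w ∷ʳ b)))

    sym : ∀ u v → ExtensionEdge w u v → ExtensionEdge w v u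
    sym (1⊗ a) (b ⊗1) e = e
    sym (b ⊗1) (1⊗ a) e = e

    irr : ∀ v → ¬ ExtensionEdge w v v
    irr (1⊗ _) ()
    irr (_ ⊗1) ()

  Biextendable : Set
  Biextendable = ∀ {w} → Word S w → Satisfiable (B w)

  record TreeSet (c : ℕ) : Set₁ where
    field
      biextendable  : Biextendable
      nonempty-tree : ∀ {w} → Word S w → w ≢ [] → IsTree (extensionGraph w)
      empty-forest  : ∃ λ (T : Fin c → Graph (A ⊎ A)) →
                      IsDisjointUnionOfTrees (extensionGraph []) T

-- θ a plays the role of a⁻¹: in the group generated by A with the relations
-- a θ(a) = 1, the inverse of a₁⋯aₙ is θ(aₙ)⋯θ(a₁).
module _ {A : Set} (θ : A → A) where

  Reduced : Pred (List A) 0ℓ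
  Reduced w = ∀ a → ¬ Infix _≡_ (a ∷ θ a ∷ []) w

  inverse : List A → List A
  inverse w = reverse (map θ w)

  record Laminary (S : FactorialSet A) : Set where
    field
      biextendable   : Biextendable S
      reduced        : ∀ {w} → Word S w → Reduced w
      inverse-closed : ∀ {w} → Word S w → Word S (inverse w)

  record Specular (S : FactorialSet A) : Set₁ where
    field
      laminary : Laminary S
      treeSet  : TreeSet S 2

{-# OPTIONS --safe #-}

-- The involution σ : 1⊗a ↦ θ(a)⊗1, b⊗1 ↦ 1⊗θ(b) is an automorphism of ℰ(ε),
-- because S is closed under inverses.  It fixes no vertex, since it exchanges
-- the two sides, and flips no edge, since a flipped edge would be a word aθ(a)
-- of S.  If some edge and its image lay in the same tree, there would be a walk
-- from a vertex x to σ(x).  Take a nonbacktracking such walk and delete its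
-- first and last edges as long as σ maps one to the other; this cannot end with
-- a fixed vertex or a flipped edge, so the resulting walk from some y to σ(y)
-- followed by its image under σ returns to y without backtracking, whereas a
-- nonbacktracking walk in an acyclic graph never revisits a vertex.

module Submission where

open import Defs
open import Algebra.Definitions using (Involutive)
open import Data.Fin.Base using (Fin; zero; suc; opposite)
open import Data.Fin.Properties using (opposite-involutive; inj⇒≟)
open import Data.List.Base using (List; []; _∷_; _++_; _∷ʳ_; map; length; initLast; _∷ʳ′_)
open import Data.List.Membership.Propositional using (_∈_)
open import Data.List.Membership.Propositional.Properties using (∈-∃++; ∈-++⁺ʳ; ∈-map⁺)
open import Data.List.Properties using (∷ʳ-++; length-++-≤ˡ)
open import Data.List.Relation.Binary.Infix.Heterogeneous using (here)
open import Data.List.Relation.Binary.Prefix.Heterogeneous using (_∷_; [])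
open import Data.List.Relation.Unary.All as All using ([]; _∷_)
open import Data.List.Relation.Unary.All.Properties using (¬Any⇒All¬; ++⁻ˡ; ++⁻ʳ)
open import Data.List.Relation.Unary.AllPairs using ([]; _∷_)
open import Data.List.Relation.Unary.Any using (here; there)
open import Data.List.Relation.Unary.Linked using (Linked; [-]; _∷_)
open import Data.List.Relation.Unary.Unique.Propositional using (Unique)
open import Data.List.Relation.Unary.Unique.Propositional.Properties using (Unique[x∷xs]⇒x∉xs)
open import Data.Nat.Base using (ℕ; suc; _≤_; _<_; s≤s)
open import Data.Nat.Properties using (n<1+n; ≤-trans)
open import Data.Product.Base using (_,_; ∃)
open import Data.Sum.Base using (_⊎_; inj₁; inj₂)
open import Data.Sum.Properties using (≡-dec)
open import Function.Base using (_∘_)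
open import Function.Bundles using (_↔_; _⇔_; mk⇔; Equivalence)
open import Function.Properties.Inverse using (↔⇒↣)
open import Relation.Binary.Construct.Closure.ReflexiveTransitive as Star using (Star; ε; _◅_)
open import Relation.Binary.Definitions using (DecidableEquality)
open import Relation.Binary.PropositionalEquality
  using (_≡_; _≢_; refl; sym; trans; cong; subst; ≢-sym)
open import Relation.Nullary using (¬_; contradiction; yes; no)

unique-first-return : ∀ {X : Set} {x : X} us {vs} → Unique (us ++ x ∷ vs) → Unique (x ∷ us)
unique-first-return []       _            = [] ∷ []
unique-first-return (u ∷ us) (u∉ ∷ uniq) with unique-first-return us uniq
... | x∉us ∷ us! = (≢-sym (All.head (++⁻ʳ us u∉)) ∷ x∉us) ∷ ++⁻ˡ us u∉ ∷ us!

module _ {X : Set} (G : Graph X) where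

  data Nonbacktracking : List X → Set where
    [-]  : ∀ {x} → Nonbacktracking (x ∷ [])
    edge : ∀ {x y} → Edge G x y → Nonbacktracking (x ∷ y ∷ [])
    step : ∀ {x y z zs} → Edge G x y → x ≢ z → Nonbacktracking (y ∷ z ∷ zs) →
           Nonbacktracking (x ∷ y ∷ z ∷ zs)

module _ {X : Set} {G : Graph X} where

  firstEdge : ∀ {x y ys} → Nonbacktracking G (x ∷ y ∷ ys) → Edge G x y
  firstEdge (edge e)     = e
  firstEdge (step e _ _) = e

  tail : ∀ {x y ys} → Nonbacktracking G (x ∷ y ∷ ys) → Nonbacktracking G (y ∷ ys)
  tail (edge _)      = [-]
  tail (step _ _ nb) = nb

  linked : ∀ {xs} → Nonbacktracking G xs → Linked (Edge G) xs
  linked [-]           = [-]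
  linked (edge e)      = e ∷ [-]
  linked (step e _ nb) = e ∷ linked nb

  prefix : ∀ xs {y ys} → Nonbacktracking G (xs ++ y ∷ ys) → Nonbacktracking G (xs ∷ʳ y)
  prefix []               _             = [-]
  prefix (_ ∷ [])         nb            = edge (firstEdge nb)
  prefix (_ ∷ b ∷ [])     (step e n nb) = step e n (prefix (b ∷ []) nb)
  prefix (_ ∷ b ∷ c ∷ xs) (step e n nb) = step e n (prefix (b ∷ c ∷ xs) nb)

  join : ∀ xs {p q r zs} → Nonbacktracking G (xs ++ p ∷ q ∷ []) → p ≢ r →
         Nonbacktracking G (q ∷ r ∷ zs) → Nonbacktracking G (xs ++ p ∷ q ∷ r ∷ zs)
  join []           nb             p≢r nb′ = step (firstEdge nb) p≢r nb′
  join (_ ∷ [])     (step e n nb)  p≢r nb′ = step e n (join [] nb p≢r nb′)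
  join (_ ∷ b ∷ []) (step e n nb)  p≢r nb′ = step e n (join (b ∷ []) nb p≢r nb′)
  join (_ ∷ b ∷ c ∷ xs) (step e n nb) p≢r nb′ = step e n (join (b ∷ c ∷ xs) nb p≢r nb′)

  reduce : DecidableEquality X → ∀ {x y} → Star (Edge G) x y →
           x ≡ y ⊎ ∃ λ ms → Nonbacktracking G (x ∷ ms ∷ʳ y)
  reduce _≟_ ε = inj₁ refl
  reduce _≟_ {x} {y} (e ◅ es) with reduce _≟_ es
  ... | inj₁ refl = inj₂ ([] , edge e)
  ... | inj₂ ([] , nb) with x ≟ y
  ...   | yes x≡y = inj₁ x≡y
  ...   | no  x≢y = inj₂ (_ ∷ [] , step e x≢y nb)
  reduce _≟_ {x} {y} (e ◅ es) | inj₂ (m ∷ ms , nb) with x ≟ m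
  ...   | yes refl = inj₂ (ms , tail nb)
  ...   | no  x≢m  = inj₂ (_ ∷ m ∷ ms , step e x≢m nb)

  map⁺ : ∀ {f : X → X} → (∀ {x y} → f x ≡ f y → x ≡ y) →
         (∀ {x y} → Edge G x y → Edge G (f x) (f y)) →
         ∀ {xs} → Nonbacktracking G xs → Nonbacktracking G (map f xs)
  map⁺ inj hom [-]           = [-]
  map⁺ inj hom (edge e)      = edge (hom e)
  map⁺ inj hom (step e n nb) = step (hom e) (n ∘ inj) (map⁺ inj hom nb)

  nonbacktracking⇒unique : Acyclic G → ∀ {xs} → Nonbacktracking G xs → Unique xs
  nonbacktracking⇒unique acyc [-] = [] ∷ []
  nonbacktracking⇒unique acyc (edge e) =
    ((λ { refl → irreflexive G e }) ∷ []) ∷ [] ∷ []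
  nonbacktracking⇒unique acyc nb@(step {x} {y} {z} {zs} e x≢z nb′) =
    ((λ { refl → irreflexive G e }) ∷ x≢z ∷ ¬Any⇒All¬ zs x∉zs) ∷ uniq
    where
    uniq = nonbacktracking⇒unique acyc nb′

    x∉zs : ¬ x ∈ zs
    x∉zs x∈zs with ∈-∃++ x∈zs
    ... | us , vs , refl =
      acyc x y z us (unique-first-return (y ∷ z ∷ us) uniq)
           (linked (prefix (x ∷ y ∷ z ∷ us) nb))

module _ {X : Set} (G : Graph X) (acyclic : Acyclic G) (σ : X → X)
         (σ-involutive : Involutive _≡_ σ)
         (σ-edge : ∀ {x y} → Edge G x y → Edge G (σ x) (σ y))
         (σ-fixes-no-vertex : ∀ x → x ≢ σ x)
         (σ-flips-no-edge : ∀ x → ¬ Edge G x (σ x)) where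

  σ-injective : ∀ {x y} → σ x ≡ σ y → x ≡ y
  σ-injective {x} {y} eq = trans (sym (σ-involutive x)) (trans (cong σ eq) (σ-involutive y))

  no-closed-walk : ∀ {x p q r zs} ns → Nonbacktracking G (x ∷ ns ++ p ∷ q ∷ []) → p ≢ r →
                   Nonbacktracking G (q ∷ r ∷ zs) → ¬ x ∈ r ∷ zs
  no-closed-walk {x} ns nb p≢r nb′ x∈ =
    Unique[x∷xs]⇒x∉xs
      (nonbacktracking⇒unique acyclic (join (x ∷ ns) nb p≢r nb′))
      (∈-++⁺ʳ ns (there (there x∈)))

  no-nonbacktracking-walk : DecidableEquality X → ∀ k ms {x} → length ms < k →
                            ¬ Nonbacktracking G (x ∷ ms ∷ʳ σ x)
  no-nonbacktracking-walk _≟_ (suc k) ms {x} (s≤s ms≤k) walk with initLast ms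
  ... | [] = σ-flips-no-edge x (firstEdge walk)
  ... | ns ∷ʳ′ p = split ns ms≤k (subst (λ ws → Nonbacktracking G (x ∷ ws)) (∷ʳ-++ ns p _) walk)
    where
    x∈image : ∀ ns → x ∈ map σ (ns ++ p ∷ σ x ∷ [])
    x∈image ns = subst (_∈ map σ (ns ++ p ∷ σ x ∷ [])) (σ-involutive x)
                        (∈-map⁺ σ (∈-++⁺ʳ ns (there (here refl))))

    image : ∀ {ws} → Nonbacktracking G ws → Nonbacktracking G (map σ ws)
    image = map⁺ σ-injective σ-edge

    split : ∀ ns → length (ns ∷ʳ p) ≤ k → ¬ Nonbacktracking G (x ∷ ns ++ p ∷ σ x ∷ [])
    split []       _    nb = no-closed-walk [] nb (σ-fixes-no-vertex p) (image nb) (x∈image [])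
    split (m ∷ ns) ns<k nb with p ≟ σ m
    ... | yes refl = no-nonbacktracking-walk _≟_ k ns
                       (≤-trans (s≤s (length-++-≤ˡ ns)) ns<k) (prefix (m ∷ ns) (tail nb))
    ... | no p≢σm  = no-closed-walk (m ∷ ns) nb p≢σm (image nb) (x∈image (m ∷ ns))

  no-walk-to-image : DecidableEquality X → ∀ {x} → ¬ Star (Edge G) x (σ x)
  no-walk-to-image _≟_ {x} walk with reduce _≟_ walk
  ... | inj₁ x≡σx        = σ-fixes-no-vertex x x≡σx
  ... | inj₂ (ms , walk′) = no-nonbacktracking-walk _≟_ (suc (length ms)) ms (n<1+n _) walk′

module _ {X : Set} {c} {G : Graph X} {T : Fin c → Graph X}
         (union : IsDisjointUnionOfTrees G T) where

  open IsDisjointUnionOfTrees union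

  edge-in-tree : ∀ {i u v} → Vertex (T i) u → Edge G u v → Edge (T i) u v
  edge-in-tree u∈Ti e with Equivalence.to (edgeUnion _ _) e
  ... | j , e′ with disjoint u∈Ti (endpoint (T j) e′)
  ... | refl = e′

  linked-in-tree : ∀ {i x xs} → Vertex (T i) x → Linked (Edge G) (x ∷ xs) →
                   Linked (Edge (T i)) (x ∷ xs)
  linked-in-tree     x∈Ti [-]      = [-]
  linked-in-tree {i} x∈Ti (e ∷ es) = e′ ∷ linked-in-tree (endpoint (T i) (symmetric (T i) e′)) es
    where e′ = edge-in-tree x∈Ti e

  forest-acyclic : Acyclic G
  forest-acyclic x y z vs uniq walk@(e ∷ _) with Equivalence.to (edgeUnion _ _) e
  ... | i , e′ = IsTree.acyclic (trees i) x y z vs uniq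
                   (linked-in-tree (endpoint (T i) e′) walk)

≢⇒≡opposite : ∀ {i j : Fin 2} → j ≢ i → j ≡ opposite i
≢⇒≡opposite {zero}     {zero}     j≢i = contradiction refl j≢i
≢⇒≡opposite {zero}     {suc zero} j≢i = refl
≢⇒≡opposite {suc zero} {zero}     j≢i = refl
≢⇒≡opposite {suc zero} {suc zero} j≢i = contradiction refl j≢i

module _ {A : Set} (θ : A → A) (θ-involutive : Involutive _≡_ θ)
         (S : FactorialSet A) (laminary : Laminary θ S) where

  open Laminary laminary

  private
    ℰ = extensionGraph S []

  flip : A ⊎ A → A ⊎ A
  flip (1⊗ a) = θ a ⊗1
  flip (b ⊗1) = 1⊗ θ b

  flip-involutive : Involutive _≡_ flip
  flip-involutive (1⊗ a) = cong 1⊗_ (θ-involutive a)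
  flip-involutive (b ⊗1) = cong _⊗1 (θ-involutive b)

  flip-edge : ∀ {u v} → Edge ℰ u v → Edge ℰ (flip u) (flip v)
  flip-edge {1⊗ a} {b ⊗1} = inverse-closed
  flip-edge {b ⊗1} {1⊗ a} = inverse-closed

  flip-fixes-no-vertex : ∀ v → v ≢ flip v
  flip-fixes-no-vertex (1⊗ _) ()
  flip-fixes-no-vertex (_ ⊗1) ()

  aθa∉S : ∀ a → ¬ Word S (a ∷ θ a ∷ [])
  aθa∉S a aθa∈S = reduced aθa∈S a (here (refl ∷ refl ∷ []))

  flip-flips-no-edge : ∀ v → ¬ Edge ℰ v (flip v)
  flip-flips-no-edge (1⊗ a) = aθa∉S a
  flip-flips-no-edge (b ⊗1) e = aθa∉S (θ b) (subst (λ c → Word S (θ b ∷ c ∷ [])) (sym (θ-involutive b)) e)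

  flip-exchanges-trees : DecidableEquality A → (T : Fin 2 → Graph (A ⊎ A)) →
                         IsDisjointUnionOfTrees ℰ T → ∀ {i u v} →
                         Edge (T i) u v → Edge (T (opposite i)) (flip u) (flip v)
  flip-exchanges-trees _≟_ T union {i} {u} {v} e
    with Equivalence.to (edgeUnion (flip u) (flip v))
           (flip-edge {u} {v} (Equivalence.from (edgeUnion u v) (i , e)))
    where open IsDisjointUnionOfTrees union
  ... | j , e′ = subst (λ k → Edge (T k) (flip u) (flip v)) (≢⇒≡opposite j≢i) e′
    where
    open IsDisjointUnionOfTrees union

    j≢i : j ≢ i
    j≢i refl =
      no-walk-to-image ℰ (forest-acyclic union) flip flip-involutive
        (λ {x} {y} → flip-edge {x} {y}) flip-fixes-no-vertex flip-flips-no-edge (≡-dec _≟_ _≟_)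
        (Star.map (λ {x} {y} e → Equivalence.from (edgeUnion x y) (i , e))
          (IsTree.connected (trees i) (endpoint (T i) e) (endpoint (T i) e′)))

proposition4p3 : ∀ {A : Set} (n : ℕ) → A ↔ Fin n →
    (θ : A → A) → Involutive _≡_ θ →
    (S : FactorialSet A) → Specular θ S →
    (T : Fin 2 → Graph (A ⊎ A)) →
    IsDisjointUnionOfTrees (extensionGraph S []) T →
    ∀ (a b : A) (i : Fin 2) →
    Edge (T i) (1⊗ a) (b ⊗1) ⇔ Edge (T (opposite i)) (1⊗ (θ b)) ((θ a) ⊗1)
proposition4p3 n A↔Fin θ θ-involutive S specular T union a b i = mk⇔ exchange exchange⁻¹
  where
  exchange : ∀ {a b i} → Edge (T i) (1⊗ a) (b ⊗1) →
             Edge (T (opposite i)) (1⊗ (θ b)) ((θ a) ⊗1)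
  exchange {i = i} e =
    symmetric (T (opposite i))
      (flip-exchanges-trees θ θ-involutive S (Specular.laminary specular)
        (inj⇒≟ (↔⇒↣ A↔Fin)) T union e)

  exchange⁻¹ : Edge (T (opposite i)) (1⊗ (θ b)) ((θ a) ⊗1) → Edge (T i) (1⊗ a) (b ⊗1)
  exchange⁻¹ e with exchange e
  ... | e′ rewrite opposite-involutive i | θ-involutive a | θ-involutive b = e′
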